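{- Let $n,k,r$ be positive integers with $r\geq 2$ and $n\geq rk$. The independence number of $\mathrm{IG}_{n,k}^{(r)}$ is $\binom{n-(r-1)k-1}{k-1}$.
   Context: Write $[n]=\{1,\ldots,n\}$ and view its elements as placed in clockwise order on a circle; a $k$-subset of $[n]$ is called a $k$-polygon. A $k$-polygon $P$ is $r$-stable if the cyclic distance (on $\mathbb{Z}/n\mathbb{Z}$) between any two distinct points of $P$ is at least $r$. Two $k$-polygons $P=\{p_1<\cdots<p_k\}$ and $Q=\{q_1<\cdots<q_k\}$ interlace if either $p_1<q_1<p_2<q_2<\cdots<p_k<q_k$ or $q_1<p_1<q_2<p_2<\cdots<q_k<p_k$. The graph $\mathrm{IG}_{n,k}^{(r)}$ has as vertices the $r$-stable $k$-polygons on $[n]$, two being adjacent iff they interlace. -}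

module Defs where

open import Data.Nat using (ℕ; zero; suc; _<_; _≤_; _⊓_; _∸_; ∣_-_∣)
open import Data.Fin using (Fin; toℕ)
open import Data.Fin.Subset using (Subset; _∈_; ∣_∣)
open import Data.Fin.Subset.Properties using (_∈?_)
open import Data.List using (List; []; _∷_; map; filter; allFin)
open import Data.List.Relation.Unary.Linked using (Linked)
open import Data.List.Relation.Unary.All using (All)
open import Data.List.Relation.Unary.AllPairs using (AllPairs)
open import Data.Sum using (_⊎_)
open import Data.Product using (_×_)
open import Relation.Binary.PropositionalEquality using (_≡_)
open import Relation.Nullary using (¬_)

-- The points of [n] are represented by Fin n, with i : Fin n standing for the
-- point toℕ i + 1 (so the circular order and all distances are preserved).
-- A subset of [n] is a Subset n (characteristic vector).

cycDist : (n : ℕ) → Fin n → Fin n → ℕ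
cycDist n i j = ∣ toℕ i - toℕ j ∣ ⊓ (n ∸ ∣ toℕ i - toℕ j ∣)

IsPolygon : (n k : ℕ) → Subset n → Set
IsPolygon n k P = ∣ P ∣ ≡ k

IsStable : (n r : ℕ) → Subset n → Set
IsStable n r P = ∀ (i j : Fin n) → i ∈ P → j ∈ P → ¬ (i ≡ j) → r ≤ cycDist n i j

IsVertex : (n k r : ℕ) → Subset n → Set
IsVertex n k r P = IsPolygon n k P × IsStable n r P

elems : {n : ℕ} → Subset n → List ℕ
elems P = map toℕ (filter (_∈? P) (allFin _))

interleave : List ℕ → List ℕ → List ℕ
interleave [] ys = ys
interleave (x ∷ xs) ys = x ∷ interleave ys xs

Interlace : {n : ℕ} → Subset n → Subset n → Set
Interlace P Q = Linked _<_ (interleave (elems P) (elems Q))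
              ⊎ Linked _<_ (interleave (elems Q) (elems P))

IsIndependent : (n k r : ℕ) → List (Subset n) → Set
IsIndependent n k r S =
  All (IsVertex n k r) S
  × AllPairs (λ P Q → ¬ (P ≡ Q)) S
  × AllPairs (λ P Q → ¬ Interlace P Q) S

IndependenceNumber : (n k r m : ℕ) → Set
IndependenceNumber n k r m =
  (Data.Product.Σ (List (Subset n)) λ S → IsIndependent n k r S × Data.List.length S ≡ m)
  × (∀ (S : List (Subset n)) → IsIndependent n k r S → Data.List.length S ≤ m)

{-# OPTIONS --safe #-}
-- Upper bound, by Pascal's rule: contract the circle edge between the last and the first
-- point of [n]. A polygon of an independent family is lost if it stops being r-stable, or
-- if it contains the last point and coincides after the contraction with another member
-- of the family. The other polygons form an independent family on n - 1 points; the lost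
-- ones, with their last vertex removed, form an independent family of (k-1)-polygons on
-- n - r points. Lower bound: no two polygons through the first point interlace.
module Submission where

open import Defs
open import Data.Nat
open import Data.Nat.Properties
open import Data.Nat.Combinatorics using (_C_; nCn≡1; nCk+nC[k+1]≡[n+1]C[k+1])
open import Data.Fin using (Fin; toℕ; zero; suc)
open import Data.Fin.Properties using (toℕ<n; toℕ-injective)
open import Data.Fin.Subset using (Subset; inside; outside; ∣_∣) renaming (_∈_ to _∈ₛ_)
open import Data.Fin.Subset.Properties using (_∈?_; ⊆-antisym)
open import Data.Vec using (here; there) renaming ([] to []ᵥ; _∷_ to _∷ᵥ_)
open import Data.Vec.Properties using (∷-injectiveʳ)
open import Data.List using (List; []; _∷_; _++_; map; filter; length; tabulate; allFin)
open import Data.List.Properties using (length-map; length-++)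
open import Data.List.Membership.Propositional using (_∈_; find; lose)
open import Data.List.Membership.Propositional.Properties
  using (∈-map⁻; ∈-map⁺; ∈-filter⁻; ∈-filter⁺; ∈-allFin)
open import Data.List.Relation.Unary.All using (All; []; _∷_)
import Data.List.Relation.Unary.All as All
import Data.List.Relation.Unary.All.Properties as All
open import Data.List.Relation.Unary.Any using (Any; here; there; any?)
open import Data.List.Relation.Unary.AllPairs using (AllPairs; []; _∷_)
import Data.List.Relation.Unary.AllPairs as AllPairs
import Data.List.Relation.Unary.AllPairs.Properties as AllPairs
open import Data.List.Relation.Unary.Linked using (Linked; []; [-]; _∷_)
open import Data.List.Relation.Unary.Unique.Propositional using (Unique)
import Data.List.Relation.Unary.Unique.Propositional.Properties as Unique
open import Data.Empty using (⊥-elim)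
open import Data.Product using (_×_; _,_; proj₁; proj₂; ∃)
open import Data.Sum using (_⊎_; inj₁; inj₂)
open import Function using (_∘_; id)
open import Relation.Binary using (Rel; Symmetric; tri<; tri≈; tri>)
open import Relation.Binary.PropositionalEquality
open import Relation.Nullary using (¬_; Dec; yes; no; does; contradiction; ¬?)
open import Relation.Nullary.Decidable using (_×-dec_; _⊎-dec_)
open import Relation.Unary using (Pred; Decidable)
open import Data.Bool using (true; false)

-- Lists and bounded quantification.

allPairs-map∈ : ∀ {a ℓ ℓ′} {A : Set a} {R : Rel A ℓ} {R′ : Rel A ℓ′} {xs : List A} →
  (∀ {x y} → x ∈ xs → y ∈ xs → R x y → R′ x y) → AllPairs R xs → AllPairs R′ xs
allPairs-map∈ f [] = []
allPairs-map∈ f (Rx ∷ Rxs) =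
  All.tabulate (λ y∈ → f (here refl) (there y∈) (All.lookup Rx y∈))
  ∷ allPairs-map∈ (λ x∈ y∈ → f (there x∈) (there y∈)) Rxs

length-filter-split : ∀ {a ℓ} {A : Set a} {P : Pred A ℓ} (P? : Decidable P) (xs : List A) →
  length xs ≡ length (filter (¬? ∘ P?) xs) + length (filter P? xs)
length-filter-split P? [] = refl
length-filter-split P? (x ∷ xs) with P? x
... | yes _ = trans (cong suc (length-filter-split P? xs)) (sym (+-suc _ _))
... | no  _ = cong suc (length-filter-split P? xs)

-- Adjoins the last index; several arguments below use it to put back a last vertex that was removed
-- or contracted.
<-snoc : ∀ {ℓ} {P : Pred ℕ ℓ} {k} → (∀ {i} → i < k → P i) → P k → ∀ {i} → i < suc k → P i
<-snoc f Pk i<1+k with m<1+n⇒m<n∨m≡n i<1+k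
... | inj₁ i<k  = f i<k
... | inj₂ refl = Pk

-- Polygons as increasing sequences.

-- A polygon with k + 1 points is given by its increasing enumeration p 0 < … < p k;
-- the values p i for i > k are irrelevant.
Seq : Set
Seq = ℕ → ℕ

-- Only the order in which `p` comes first; `apart` ranges over ordered pairs and so excludes both
-- orders.
Interlaced : ℕ → Seq → Seq → Set
Interlaced k p q = (∀ {i} → i < suc k → p i < q i) × (∀ {i} → i < k → q i < p (suc i))

Agree : ℕ → Seq → Seq → Set
Agree k p q = ∀ {i} → i < suc k → p i ≡ q i

agree? : ∀ k p q → Dec (Agree k p q)
agree? k p q = allUpTo? (λ i → p i ≟ q i) (suc k)

-- For a polygon through the last point: that point becomes the first vertex 0, the others move up
-- one index, and the old last value falls out of range.
shift : Seq → Seq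
shift p zero    = 0
shift p (suc i) = p i

-- Merges the point n of the circle 0, …, n into the point 0.
contract : ℕ → ℕ → Seq → Seq
contract n k p with p k ≟ n
... | yes _ = shift p
... | no  _ = p

-- For k = 0 the field wrap says r ≤ n, which IsStable does not imply.
record Stable (r n k : ℕ) (p : Seq) : Set where
  field
    gap   : ∀ {i} → i < k → p i + r ≤ p (suc i)
    wrap  : p k + r ≤ p 0 + n
    bound : p k < n

record Independent (r n k : ℕ) (S : List Seq) : Set where
  field
    stable   : ∀ {p} → p ∈ S → Stable r n k p
    apart    : ∀ {p q} → p ∈ S → q ∈ S → ¬ Interlaced k p q
    distinct : AllPairs (λ p q → ¬ Agree k p q) S

-- Base cases: circles that are too small, and single points.

module _ (r : ℕ) (2≤r : 2 ≤ r) where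

  private
    1≤r : 1 ≤ r
    1≤r = ≤-trans (n≤1+n 1) 2≤r

  open Stable
  open Independent

  -- The vertices cut the circle into `suc k` arcs, each of length at least `r`.
  stable⇒large : ∀ {n k p} → Stable r n k p → r * suc k ≤ n
  stable⇒large {n} {k} {p} s = +-cancelˡ-≤ (p 0) _ _ (begin
    p 0 + r * suc k     ≡⟨ cong (p 0 +_) (trans (*-suc r k) (+-comm r _)) ⟩
    p 0 + (r * k + r)   ≡⟨ +-assoc (p 0) _ r ⟨
    (p 0 + r * k) + r   ≤⟨ +-monoˡ-≤ r (grow k ≤-refl) ⟩
    p k + r             ≤⟨ wrap s ⟩
    p 0 + n             ∎)
    where
    open ≤-Reasoning
    grow : ∀ i → i ≤ k → p 0 + r * i ≤ p i
    grow zero    _   = ≤-reflexive (trans (cong (p 0 +_) (*-zeroʳ r)) (+-identityʳ _))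
    grow (suc i) i<k = begin
      p 0 + r * suc i     ≡⟨ cong (p 0 +_) (trans (*-suc r i) (+-comm r _)) ⟩
      p 0 + (r * i + r)   ≡⟨ +-assoc (p 0) _ r ⟨
      (p 0 + r * i) + r   ≤⟨ +-monoˡ-≤ r (grow i (<⇒≤ i<k)) ⟩
      p i + r             ≤⟨ gap s i<k ⟩
      p (suc i)           ∎

  independent-empty : ∀ {n k S} → n < r * suc k → Independent r n k S → length S ≡ 0
  independent-empty {S = []}    _     _ = refl
  independent-empty {S = _ ∷ _} small I =
    contradiction (stable⇒large (stable I (here refl))) (<⇒≱ small)

  -- With one vertex each, interlacing only asks for `p 0 < q 0`, so two distinct points always
  -- interlace in one of the orders.
  independent-points : ∀ {n S} → Independent r n 0 S → length S ≤ 1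
  independent-points {S = []}        _ = z≤n
  independent-points {S = _ ∷ []}    _ = ≤-refl
  independent-points {S = p ∷ q ∷ _} I with <-cmp (p 0) (q 0) | distinct I
  ... | tri< p<q _ _ | _ =
    ⊥-elim (apart I (here refl) (there (here refl)) (<-snoc {P = λ i → p i < q i} (λ ()) p<q , λ ()))
  ... | tri≈ _ p≡q _ | (p≢q ∷ _) ∷ _ = ⊥-elim (p≢q (<-snoc {P = λ i → p i ≡ q i} (λ ()) p≡q))
  ... | tri> _ _ q<p | _ =
    ⊥-elim (apart I (there (here refl)) (here refl) (<-snoc {P = λ i → q i < p i} (λ ()) q<p , λ ()))

  -- The contraction step: kept and lost polygons.

  module Contraction {n m k : ℕ} (1+n≡m+r : suc n ≡ m + r)
                     {S : List Seq} (I : Independent r (suc n) (suc k) S) where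

    -- The arc from the last vertex to the first has length exactly `r`, so it cannot be shortened
    -- by one.
    Tight : Seq → Set
    Tight p = p (suc k) + r ≡ p 0 + suc n

    -- For `p` in `S`, the partner passes through 0 and ends at `p k`, below `n`: contraction fixes
    -- it and moves `p` onto it.
    Paired : Seq → Set
    Paired p = p (suc k) ≡ n × Any (Agree (suc k) (shift p)) S

    Lost : Seq → Set
    Lost p = Tight p ⊎ Paired p

    lost? : Decidable Lost
    lost? p = (p (suc k) + r ≟ p 0 + suc n)
      ⊎-dec ((p (suc k) ≟ n) ×-dec any? (agree? (suc k) (shift p)) S)

    paired : ∀ {p q} → p (suc k) ≡ n → q ∈ S → Agree (suc k) (shift p) q → Lost p
    paired {p} p≡n q∈ e = inj₂ (p≡n , lose {P = Agree (suc k) (shift p)} q∈ e)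

    kept lost : List Seq
    kept = map (contract n (suc k)) (filter (¬? ∘ lost?) S)
    lost = filter lost? S

    length-kept+lost : length S ≡ length kept + length lost
    length-kept+lost = trans (length-filter-split lost? S)
      (cong (_+ length lost) (sym (length-map _ (filter (¬? ∘ lost?) S))))

    -- Only the arc from the last vertex to the first gets shorter, and it has a unit to spare when
    -- `p` is not tight. If `p` passes through `n`, this arc turns into the first gap and the old
    -- last gap turns into the wrap.
    contract-stable : ∀ {p} → p ∈ S → ¬ Lost p → Stable r n (suc k) (contract n (suc k) p)
    contract-stable {p} p∈ ¬L with p (suc k) ≟ n | stable I p∈
    ... | no  p≢n | s = record
      { gap   = gap s
      ; wrap  = ≤-pred (subst (suc (p (suc k) + r) ≤_) (+-suc (p 0) n)
                  (≤∧≢⇒< (wrap s) (¬L ∘ inj₁)))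
      ; bound = ≤∧≢⇒< (≤-pred (bound s)) p≢n
      }
    ... | yes p≡n | s = record
      { gap   = λ { {zero} _ → r≤p0 ; {suc i} (s≤s i<k) → gap s (m≤n⇒m≤1+n i<k) }
      ; wrap  = subst (p k + r ≤_) p≡n (gap s ≤-refl)
      ; bound = subst (p k <_) p≡n
                  (<-≤-trans (m<m+n (p k) 1≤r) (gap s ≤-refl))
      }
      where
      r≤p0 : r ≤ p 0
      r≤p0 = +-cancelˡ-≤ n _ _ (≤-pred (begin-strict
        n + r           ≡⟨ cong (_+ r) p≡n ⟨
        p (suc k) + r   <⟨ ≤∧≢⇒< (wrap s) (¬L ∘ inj₁) ⟩
        p 0 + suc n     ≡⟨ +-comm (p 0) (suc n) ⟩
        suc (n + p 0)   ∎))
        where open ≤-Reasoning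

    -- If `q` passes through `n`, its contraction starts at 0 and cannot come second. If only `p`
    -- does, moving its vertex 0 back to `n` puts it behind all of `q`, and `q` and `p` interlace
    -- with `q` first.
    contract-apart : ∀ {p q} → p ∈ S → q ∈ S →
      ¬ Interlaced (suc k) (contract n (suc k) p) (contract n (suc k) q)
    contract-apart {p} {q} p∈ q∈ with p (suc k) ≟ n | q (suc k) ≟ n
    ... | no  _   | no  _   = apart I p∈ q∈
    ... | _       | yes _   = λ (lt , _) → contradiction (lt {0} (s≤s z≤n)) λ ()
    ... | yes p≡n | no  q≢n = λ (lt , gt) → apart I q∈ p∈
      ( <-snoc gt (subst (q (suc k) <_) (sym p≡n) (≤∧≢⇒< (≤-pred (bound (stable I q∈))) q≢n))
      , (λ i<k → lt (s≤s i<k)) )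

    -- Distinct polygons can collide only if exactly one of them passes through `n`, and that one is
    -- then paired.
    contract-agree : ∀ {p q} → p ∈ S → q ∈ S → ¬ Lost p → ¬ Lost q →
      Agree (suc k) (contract n (suc k) p) (contract n (suc k) q) → Agree (suc k) p q
    contract-agree {p} {q} p∈ q∈ ¬Lp ¬Lq with p (suc k) ≟ n | q (suc k) ≟ n
    ... | no  _   | no  _   = λ e → e
    ... | yes p≡n | yes q≡n = λ e → <-snoc (λ i<k → e (s≤s i<k)) (trans p≡n (sym q≡n))
    ... | yes p≡n | no  _   = λ e → ⊥-elim (¬Lp (paired p≡n q∈ e))
    ... | no  _   | yes q≡n = λ e → ⊥-elim (¬Lq (paired q≡n p∈ (λ i<k → sym (e i<k))))

    contract-distinct : ∀ {p q} → p ∈ S → q ∈ S → ¬ Lost p → ¬ Lost q → ¬ Agree (suc k) p q →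
      ¬ Agree (suc k) (contract n (suc k) p) (contract n (suc k) q)
    contract-distinct p∈ q∈ ¬Lp ¬Lq p≢q e = p≢q (contract-agree p∈ q∈ ¬Lp ¬Lq e)

    kept-independent : Independent r n (suc k) kept
    kept-independent = record
      { stable   = λ p∈ → stable-kept (∈-map⁻ (contract n (suc k)) p∈)
      ; apart    = λ p∈ q∈ → apart-kept (∈-map⁻ (contract n (suc k)) p∈)
                                        (∈-map⁻ (contract n (suc k)) q∈)
      ; distinct = AllPairs.map⁺ (allPairs-map∈
          (λ p∈ q∈ p≢q → let (p∈S , ¬Lp) = ∈-filter⁻ (¬? ∘ lost?) p∈
                             (q∈S , ¬Lq) = ∈-filter⁻ (¬? ∘ lost?) q∈
                         in contract-distinct p∈S q∈S ¬Lp ¬Lq p≢q)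
          (AllPairs.filter⁺ (¬? ∘ lost?) (distinct I)))
      }
      where
      Kept : Seq → Set
      Kept p′ = ∃ λ p → p ∈ filter (¬? ∘ lost?) S × p′ ≡ contract n (suc k) p
      stable-kept : ∀ {p} → Kept p → Stable r n (suc k) p
      stable-kept (p , p∈ , refl) = let (p∈S , ¬Lp) = ∈-filter⁻ (¬? ∘ lost?) p∈
                                    in contract-stable p∈S ¬Lp
      apart-kept : ∀ {p q} → Kept p → Kept q → ¬ Interlaced (suc k) p q
      apart-kept (p , p∈ , refl) (q , q∈ , refl) =
        contract-apart (proj₁ (∈-filter⁻ (¬? ∘ lost?) p∈)) (proj₁ (∈-filter⁻ (¬? ∘ lost?) q∈))

    m≤n : m ≤ n
    m≤n = ≤-pred (subst (suc m ≤_) (sym 1+n≡m+r) (m<m+n m 1≤r))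

    tight-last : ∀ p → Tight p → p (suc k) ≡ p 0 + m
    tight-last p t = +-cancelʳ-≡ r _ _ (trans t
      (trans (cong (p 0 +_) 1+n≡m+r) (sym (+-assoc (p 0) m r))))

    tight-first : ∀ {p} → p ∈ S → Tight p → p 0 < r
    tight-first {p} p∈ t = +-cancelʳ-< m _ _ (begin-strict
      p 0 + m     ≡⟨ tight-last p t ⟨
      p (suc k)   <⟨ bound (stable I p∈) ⟩
      suc n       ≡⟨ trans 1+n≡m+r (+-comm m r) ⟩
      r + m       ∎)
      where open ≤-Reasoning

    -- The first two vertices of the partner are 0 and `p 0`. Together with `tight-first`, the first
    -- vertex of a lost polygon tells which kind of loss occurred.
    paired-first : ∀ p → Paired p → r ≤ p 0
    paired-first _ (_ , a) = let (q , q∈ , e) = find a in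
      subst₂ (λ x y → x + r ≤ y) (sym (e (s≤s z≤n))) (sym (e (s≤s (s≤s z≤n)))) (gap (stable I q∈) (s≤s z≤n))

    penultimate : ∀ {p} → p ∈ S → p k < m
    penultimate {p} p∈ = +-cancelʳ-< r _ _ (begin-strict
      p k + r     ≤⟨ gap (stable I p∈) ≤-refl ⟩
      p (suc k)   <⟨ bound (stable I p∈) ⟩
      suc n       ≡⟨ 1+n≡m+r ⟩
      m + r       ∎)
      where open ≤-Reasoning

    lost-last : ∀ p → Lost p → m ≤ p (suc k)
    lost-last p (inj₁ t) = subst (m ≤_) (sym (tight-last p t)) (m≤n+m m (p 0))
    lost-last p (inj₂ (p≡n , _)) = subst (m ≤_) (sym p≡n) m≤n

    -- Only the wrap is at stake. A tight polygon ends at `p 0 + m`, so its last gap is the new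
    -- wrap; for a paired one, `p k < m` and `r ≤ p 0` suffice.
    init-stable : ∀ {p} → p ∈ S → Lost p → Stable r m k p
    init-stable {p} p∈ L = record
      { gap   = λ i<k → gap s (m≤n⇒m≤1+n i<k)
      ; wrap  = init-wrap L
      ; bound = penultimate p∈
      }
      where
      s = stable I p∈
      init-wrap : Lost p → p k + r ≤ p 0 + m
      init-wrap (inj₁ t) = subst (p k + r ≤_) (tight-last p t) (gap s ≤-refl)
      init-wrap (inj₂ P) = subst (p k + r ≤_) (+-comm m (p 0))
        (+-mono-≤ (<⇒≤ (penultimate p∈)) (paired-first p P))

    -- From interlacing truncations an interlacing pair in `S` is recovered: `p` and `q` themselves
    -- if their last vertices are in the right order, otherwise the partner of `q` and `p`. A paired
    -- `p` with a tight `q` is impossible, since their first vertices are in the wrong order.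
    init-apart : ∀ {p q} → p ∈ S → q ∈ S → Lost p → Lost q → ¬ Interlaced k p q
    init-apart {p} {q} p∈ q∈ Lp Lq (lt , gt) = separate Lp Lq
      where
      -- This includes the removed vertex of `p`: `q k < m ≤ p (suc k)`.
      q<p : ∀ {i} → i < suc k → q i < p (suc i)
      q<p = <-snoc gt (<-≤-trans (penultimate q∈) (lost-last p Lp))

      last-apart : ¬ p (suc k) < q (suc k)
      last-apart l = apart I p∈ q∈ (<-snoc lt l , q<p)

      -- The partner `q′` is 0 followed by `q 0`, ..., `q k`, so it interlaces with `p` from the
      -- front once 0 lies before `p 0`.
      shift-apart : Paired q → 0 < p 0 → ¬ Interlaced k p q
      shift-apart (_ , a) 0<p0 _ = let (q′ , q′∈ , e) = find a in apart I q′∈ p∈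
        ( (λ { {zero} i< → subst (_< p 0) (e i<) 0<p0
             ; {suc i} i< → subst (_< p (suc i)) (e i<) (q<p (≤-pred i<)) })
        , (λ {i} i< → subst (p i <_) (e (s≤s i<)) (lt i<)) )

      separate : Lost p → ¬ Lost q
      separate (inj₁ tp) (inj₁ tq) = last-apart
        (subst₂ _<_ (sym (tight-last p tp)) (sym (tight-last q tq)) (+-monoˡ-< m (lt (s≤s z≤n))))
      separate (inj₂ Pp) (inj₁ tq) =
        <⇒≱ (<-trans (lt (s≤s z≤n)) (tight-first q∈ tq)) (paired-first p Pp)
      separate (inj₂ Pp) (inj₂ Pq) = shift-apart Pq (≤-trans 1≤r (paired-first p Pp)) (lt , gt)
      separate (inj₁ tp) (inj₂ Pq) with p 0 ≟ 0
      ... | no  p0≢0 = shift-apart Pq (n≢0⇒n>0 p0≢0) (lt , gt)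
      -- 1 ≤ r would not suffice here: since 2 ≤ r, a tight polygon through 0 misses n.
      ... | yes p0≡0 = last-apart (subst₂ _<_
        (sym (trans (tight-last p tp) (cong (_+ m) p0≡0))) (sym (proj₁ Pq))
        (≤-pred (subst (suc (suc m) ≤_) (sym 1+n≡m+r)
          (subst (_≤ m + r) (+-comm m 2) (+-monoʳ-≤ m 2≤r)))))

    -- The last vertex is recoverable: it is `p 0 + m` for a tight polygon and `n` for a paired one,
    -- and the common first vertex decides between the two.
    init-agree : ∀ {p q} → p ∈ S → q ∈ S → Lost p → Lost q → Agree k p q → Agree (suc k) p q
    init-agree {p} {q} p∈ q∈ Lp Lq e = <-snoc e (last-agree Lp Lq)
      where
      p0≡q0 = e (s≤s z≤n)
      last-agree : Lost p → Lost q → p (suc k) ≡ q (suc k)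
      last-agree (inj₁ tp) (inj₁ tq) =
        trans (tight-last p tp) (trans (cong (_+ m) p0≡q0) (sym (tight-last q tq)))
      last-agree (inj₁ tp) (inj₂ Pq) = contradiction
        (subst (r ≤_) (sym p0≡q0) (paired-first q Pq)) (<⇒≱ (tight-first p∈ tp))
      last-agree (inj₂ Pp) (inj₁ tq) = contradiction
        (subst (r ≤_) p0≡q0 (paired-first p Pp)) (<⇒≱ (tight-first q∈ tq))
      last-agree (inj₂ (p≡n , _)) (inj₂ (q≡n , _)) = trans p≡n (sym q≡n)

    init-distinct : ∀ {p q} → p ∈ S → q ∈ S → Lost p → Lost q →
      ¬ Agree (suc k) p q → ¬ Agree k p q
    init-distinct p∈ q∈ Lp Lq p≢q e = p≢q (init-agree p∈ q∈ Lp Lq e)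

    lost-independent : Independent r m k lost
    lost-independent = record
      { stable   = λ p∈ → let (p∈S , Lp) = ∈-filter⁻ lost? p∈ in init-stable p∈S Lp
      ; apart    = λ p∈ q∈ → let (p∈S , Lp) = ∈-filter⁻ lost? p∈
                                 (q∈S , Lq) = ∈-filter⁻ lost? q∈
                             in init-apart p∈S q∈S Lp Lq
      ; distinct = allPairs-map∈
          (λ p∈ q∈ p≢q → let (p∈S , Lp) = ∈-filter⁻ lost? p∈
                             (q∈S , Lq) = ∈-filter⁻ lost? q∈
                         in init-distinct p∈S q∈S Lp Lq p≢q)
          (AllPairs.filter⁺ lost? (distinct I))
      }

  -- Here `d` is the slack of the circle. Contraction costs one unit of slack; truncation removes
  -- one vertex and `r` points and preserves the slack. These are the two terms of Pascal's rule.
  independent-bound : ∀ k d {n S} → n ≡ r * suc k + d → Independent r n k S →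
                      length S ≤ (k + d) C k
  independent-bound zero    d _ I = independent-points I
  independent-bound (suc k) d {zero} n≡ I =
    ≤-trans (≤-reflexive (independent-empty
      (≤-trans 1≤r (m≤m*n r (suc (suc k)))) I)) z≤n
  independent-bound (suc k) d {suc n} {S} 1+n≡ I = begin
    length S                              ≡⟨ length-kept+lost ⟩
    length kept + length lost             ≤⟨ +-mono-≤ (kept-bound d 1+n≡) lost-bound ⟩
    (k + d) C suc k + (k + d) C k         ≡⟨ +-comm ((k + d) C suc k) _ ⟩
    (k + d) C k + (k + d) C suc k         ≡⟨ nCk+nC[k+1]≡[n+1]C[k+1] (k + d) k ⟩
    suc (k + d) C suc k                   ∎
    where
    open ≤-Reasoning
    open Contraction {m = r * suc k + d} (trans 1+n≡
      (trans (cong (_+ d) (*-suc r (suc k)))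
        (trans (+-assoc r _ d) (+-comm r _)))) I
    lost-bound : length lost ≤ (k + d) C k
    lost-bound = independent-bound k d refl lost-independent
    kept-bound : ∀ d → suc n ≡ r * suc (suc k) + d → length kept ≤ (k + d) C suc k
    -- Without slack, the contracted circle has no room for a stable polygon.
    kept-bound zero    eq = ≤-trans (≤-reflexive (independent-empty
      (≤-reflexive (trans eq (+-identityʳ _))) kept-independent)) z≤n
    kept-bound (suc d) eq = subst (λ x → length kept ≤ x C suc k) (sym (+-suc k d))
      (independent-bound (suc k) d (suc-injective (trans eq (+-suc _ d))) kept-independent)

-- From subsets to sequences.

allPairs-lookup : ∀ {a ℓ} {A : Set a} {R : Rel A ℓ} {xs : List A} → Symmetric R →
  AllPairs R xs → ∀ {x y} → x ∈ xs → y ∈ xs → x ≡ y ⊎ R x y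
allPairs-lookup R-sym (_  ∷ _)   (here refl) (here refl) = inj₁ refl
allPairs-lookup R-sym (Rx ∷ _)   (here refl) (there y∈)  = inj₂ (All.lookup Rx y∈)
allPairs-lookup R-sym (Rx ∷ _)   (there x∈)  (here refl) = inj₂ (R-sym (All.lookup Rx x∈))
allPairs-lookup R-sym (_  ∷ Rxs) (there x∈)  (there y∈)  = allPairs-lookup R-sym Rxs x∈ y∈

nth : List ℕ → Seq
nth []       _       = 0
nth (x ∷ _)  zero    = x
nth (_ ∷ xs) (suc i) = nth xs i

nth-∈ : ∀ xs {i} → i < length xs → nth xs i ∈ xs
nth-∈ (_ ∷ _)  {zero}  _         = here refl
nth-∈ (_ ∷ xs) {suc i} (s≤s i<l) = there (nth-∈ xs i<l)

nth-mono : ∀ {xs} → AllPairs _<_ xs → ∀ {i j} → i < j → j < length xs → nth xs i < nth xs j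
nth-mono {_ ∷ xs} (x< ∷ _)  {zero}  {suc j} _         (s≤s j<l) = All.lookup x< (nth-∈ xs j<l)
nth-mono          (_ ∷ xs↑) {suc i} {suc j} (s≤s i<j) (s≤s j<l) = nth-mono xs↑ i<j j<l

nth-injective : ∀ xs ys → length xs ≡ length ys →
  (∀ {i} → i < length xs → nth xs i ≡ nth ys i) → xs ≡ ys
nth-injective []       []       _  _ = refl
nth-injective (x ∷ xs) (y ∷ ys) eq e =
  cong₂ _∷_ (e z<s) (nth-injective xs ys (suc-injective eq) (e ∘ s<s))

interleave-linked : ∀ xs ys → length xs ≡ length ys →
  (∀ {i} → i < length xs → nth xs i < nth ys i) →
  (∀ {i} → suc i < length xs → nth ys i < nth xs (suc i)) →
  Linked _<_ (interleave xs ys)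
interleave-linked []           []           _  _  _  = []
interleave-linked (_ ∷ [])     (_ ∷ [])     _  lt _  = lt z<s ∷ [-]
interleave-linked (_ ∷ _ ∷ xs) (_ ∷ _ ∷ ys) eq lt gt =
  lt z<s ∷ gt (s<s z<s) ∷
  interleave-linked (_ ∷ xs) (_ ∷ ys) (suc-injective eq) (lt ∘ s<s) (gt ∘ s<s)

-- The minimum is over the two arcs between `a` and `b`; each contributes one inequality.
cyc-distance⁻ : ∀ {r n a b} → a ≤ b → b < n → r ≤ ∣ a - b ∣ ⊓ (n ∸ ∣ a - b ∣) →
  a + r ≤ b × b + r ≤ a + n
cyc-distance⁻ {r} {n} {a} {b} a≤b b<n far rewrite m≤n⇒∣m-n∣≡n∸m a≤b =
  subst (_≤ b) (+-comm r a) (m≤o∸n⇒m+n≤o r a≤b (m≤n⊓o⇒m≤n _ _ far)) ,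
  (begin
    b + r               ≡⟨ cong (_+ r) (m+[n∸m]≡n a≤b) ⟨
    (a + (b ∸ a)) + r   ≡⟨ +-assoc a _ r ⟩
    a + ((b ∸ a) + r)   ≡⟨ cong (a +_) (+-comm (b ∸ a) r) ⟩
    a + (r + (b ∸ a))   ≤⟨ +-monoʳ-≤ a (m≤o∸n⇒m+n≤o r
                             (≤-trans (m∸n≤m b a) (<⇒≤ b<n)) (m≤n⊓o⇒m≤o _ _ far)) ⟩
    a + n               ∎)
  where open ≤-Reasoning

-- The second hypothesis bounds the wrapping arc by its part after `b` alone, which is the form that
-- `end` of `Spread` provides.
cyc-distance⁺ : ∀ {r n a b} → a + r ≤ b → b + r ≤ n → r ≤ ∣ a - b ∣ ⊓ (n ∸ ∣ a - b ∣)
cyc-distance⁺ {r} {n} {a} {b} a+r≤b b+r≤n rewrite m≤n⇒∣m-n∣≡n∸m (m+n≤o⇒m≤o a a+r≤b) =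
  ⊓-glb (m+n≤o⇒m≤o∸n r (subst (_≤ b) (+-comm a r) a+r≤b))
        (m+n≤o⇒m≤o∸n r (≤-trans (+-monoʳ-≤ r (m∸n≤m b a)) (subst (_≤ n) (+-comm b r) b+r≤n)))

∈-elems⁺ : ∀ {n} {P : Subset n} {f} → f ∈ₛ P → toℕ f ∈ elems P
∈-elems⁺ {P = P} f∈ = ∈-map⁺ toℕ (∈-filter⁺ (_∈? P) (∈-allFin _) f∈)

∈-elems⁻ : ∀ {n} {P : Subset n} {x} → x ∈ elems P → ∃ λ f → f ∈ₛ P × x ≡ toℕ f
∈-elems⁻ {P = P} x∈ = let (f , f∈ , eq) = ∈-map⁻ toℕ x∈
                      in f , proj₂ (∈-filter⁻ (_∈? P) {xs = allFin _} f∈) , eq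

elems-sorted : ∀ {n} (P : Subset n) → AllPairs _<_ (elems P)
elems-sorted P = AllPairs.map⁺ (AllPairs.filter⁺ (_∈? P) (AllPairs.tabulate⁺-< id))

elems-injective : ∀ {n} {P Q : Subset n} → elems P ≡ elems Q → P ≡ Q
elems-injective eq = ⊆-antisym (included eq) (included (sym eq))
  where
  included : ∀ {n} {P Q : Subset n} → elems P ≡ elems Q → ∀ {f} → f ∈ₛ P → f ∈ₛ Q
  included {Q = Q} eq {f} f∈ =
    let (g , g∈ , f≡g) = ∈-elems⁻ {P = Q} (subst (toℕ f ∈_) eq (∈-elems⁺ f∈))
    in subst (_∈ₛ Q) (sym (toℕ-injective f≡g)) g∈

length-elems : ∀ {n} (P : Subset n) → length (elems P) ≡ ∣ P ∣
length-elems P = trans (length-map toℕ (filter (_∈? P) (allFin _))) (size P)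
  where
  drop-head : ∀ {m n} s (P : Subset n) (f : Fin m → Fin n) →
    length (filter (_∈? (s ∷ᵥ P)) (tabulate (suc ∘ f))) ≡ length (filter (_∈? P) (tabulate f))
  drop-head {zero}  s P f = refl
  -- The decision for `suc (f zero)` in `s ∷ᵥ P` computes to this one, so both filters branch
  -- together.
  drop-head {suc m} s P f with does (f zero ∈? P)
  ... | true  = cong suc (drop-head s P (f ∘ suc))
  ... | false = drop-head s P (f ∘ suc)

  size : ∀ {n} (P : Subset n) → length (filter (_∈? P) (allFin n)) ≡ ∣ P ∣
  size []ᵥ            = refl
  size (inside  ∷ᵥ P) = cong suc (trans (drop-head inside P id) (size P))
  size (outside ∷ᵥ P) = trans (drop-head outside P id) (size P)

sequence : ∀ {n} → Subset n → Seq
sequence P = nth (elems P)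

module _ {n k : ℕ} {P : Subset n} (∣P∣≡1+k : ∣ P ∣ ≡ suc k) where

  length-polygon : length (elems P) ≡ suc k
  length-polygon = trans (length-elems P) ∣P∣≡1+k

  below : ∀ {i} → i < suc k → i < length (elems P)
  below {i} = subst (i <_) (sym length-polygon)

  sequence-∈ : ∀ {i} → i < suc k → ∃ λ f → f ∈ₛ P × sequence P i ≡ toℕ f
  sequence-∈ i≤k = ∈-elems⁻ (nth-∈ (elems P) (below i≤k))

  sequence-stable : ∀ {r} → r ≤ n → IsStable n r P → Stable r n k (sequence P)
  sequence-stable {r} r≤n stable = record
    { gap   = λ i<k → proj₁ (apart ≤-refl (s≤s i<k))
    ; wrap  = wrap k ≤-refl
    ; bound = let (f , _ , eq) = sequence-∈ ≤-refl in subst (_< n) (sym eq) (toℕ<n f)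
    }
    where
    apart : ∀ {i j} → i < j → j < suc k →
      sequence P i + r ≤ sequence P j × sequence P j + r ≤ sequence P i + n
    apart {i} {j} i<j j≤k with sequence-∈ (<-trans i<j j≤k) | sequence-∈ j≤k
      | nth-mono (elems-sorted P) i<j (below j≤k)
    ... | f , f∈ , pi≡f | g , g∈ , pj≡g | pi<pj rewrite pi≡f | pj≡g =
      cyc-distance⁻ (<⇒≤ pi<pj) (toℕ<n g) (stable f g f∈ g∈ λ f≡g → <⇒≢ pi<pj (cong toℕ f≡g))

    wrap : ∀ j → j < suc k → sequence P j + r ≤ sequence P 0 + n
    -- A single vertex has no other vertex to be far from, so `r ≤ n` has to supply the wrap.
    wrap zero    _   = +-monoʳ-≤ (sequence P 0) r≤n
    wrap (suc j) j≤k = proj₂ (apart z<s j≤k)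

  sequence-agree : ∀ {Q : Subset n} → ∣ Q ∣ ≡ suc k → Agree k (sequence P) (sequence Q) → P ≡ Q
  sequence-agree {Q} ∣Q∣≡1+k e = elems-injective (nth-injective (elems P) (elems Q)
    (trans length-polygon (sym (trans (length-elems Q) ∣Q∣≡1+k)))
    (λ {i} i< → e (subst (i <_) length-polygon i<)))

  sequence-interlaced : ∀ (Q : Subset n) → ∣ Q ∣ ≡ suc k → Interlaced k (sequence P) (sequence Q) →
    Linked _<_ (interleave (elems P) (elems Q))
  sequence-interlaced Q ∣Q∣≡1+k (lt , gt) = interleave-linked (elems P) (elems Q)
    (trans length-polygon (sym (trans (length-elems Q) ∣Q∣≡1+k)))
    (λ {i} i< → lt (subst (i <_) length-polygon i<))
    (λ {i} i< → gt (≤-pred (subst (suc i <_) length-polygon i<)))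

sequences-independent : ∀ {n k r S} → r ≤ n → IsIndependent n (suc k) r S →
  Independent r n k (map sequence S)
sequences-independent {n} {k} {r} {S} r≤n (vertices , distinct , apart) = record
  { stable   = λ p∈ → stable′ (∈-map⁻ sequence p∈)
  ; apart    = λ p∈ q∈ → apart′ (∈-map⁻ sequence p∈) (∈-map⁻ sequence q∈)
  ; distinct = AllPairs.map⁺ (allPairs-map∈
      (λ {P} {Q} P∈ Q∈ → distinct′ {P} {Q} P∈ Q∈) distinct)
  }
  where
  size : ∀ {P} → P ∈ S → ∣ P ∣ ≡ suc k
  size P∈ = proj₁ (All.lookup vertices P∈)

  distinct′ : ∀ {P Q} → P ∈ S → Q ∈ S → ¬ (P ≡ Q) → ¬ Agree k (sequence P) (sequence Q)
  distinct′ P∈ Q∈ P≢Q e = P≢Q (sequence-agree (size P∈) (size Q∈) e)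

  stable′ : ∀ {p} → (∃ λ P → P ∈ S × p ≡ sequence P) → Stable r n k p
  stable′ (P , P∈ , refl) = sequence-stable (size P∈) r≤n (proj₂ (All.lookup vertices P∈))

  apart′ : ∀ {p q} → (∃ λ P → P ∈ S × p ≡ sequence P) → (∃ λ Q → Q ∈ S × q ≡ sequence Q) →
    ¬ Interlaced k p q
  apart′ (P , P∈ , refl) (Q , Q∈ , refl) PQ
    with allPairs-lookup (λ ¬PQ → ¬PQ ∘ λ { (inj₁ x) → inj₂ x ; (inj₂ x) → inj₁ x }) apart P∈ Q∈
  ... | inj₁ refl = <-irrefl refl (proj₁ PQ z<s)
  ... | inj₂ ¬PQ  = ¬PQ (inj₁ (sequence-interlaced {P = P} (size P∈) Q (size Q∈) PQ))

-- Lower bound: spread sets in a row.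

-- The k-subsets of n points in a row, the first c of which are forbidden, such that
-- every chosen point is followed by r′ further points, none of them chosen.
spreadSets : (r′ c n k : ℕ) → List (Subset n)
spreadSets r′ zero    zero    zero    = []ᵥ ∷ []
spreadSets r′ zero    zero    (suc k) = []
spreadSets r′ (suc c) zero    k       = []
spreadSets r′ (suc c) (suc n) k       = map (outside ∷ᵥ_) (spreadSets r′ c n k)
spreadSets r′ zero    (suc n) zero    = map (outside ∷ᵥ_) (spreadSets r′ zero n zero)
spreadSets r′ zero    (suc n) (suc k) =
  map (outside ∷ᵥ_) (spreadSets r′ zero n (suc k)) ++ map (inside ∷ᵥ_) (spreadSets r′ r′ n k)

spreadSets-unique : ∀ r′ c n k → Unique (spreadSets r′ c n k)
spreadSets-unique r′ zero    zero    zero    = [] ∷ []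
spreadSets-unique r′ zero    zero    (suc k) = []
spreadSets-unique r′ (suc c) zero    k       = []
spreadSets-unique r′ (suc c) (suc n) k       = Unique.map⁺ ∷-injectiveʳ (spreadSets-unique r′ c n k)
spreadSets-unique r′ zero    (suc n) zero    = Unique.map⁺ ∷-injectiveʳ (spreadSets-unique r′ zero n zero)
spreadSets-unique r′ zero    (suc n) (suc k) = Unique.++⁺
  (Unique.map⁺ ∷-injectiveʳ (spreadSets-unique r′ zero n (suc k)))
  (Unique.map⁺ ∷-injectiveʳ (spreadSets-unique r′ r′ n k))
  λ (out , ins) → heads-differ (∈-map⁻ _ out) (∈-map⁻ _ ins)
  where
  heads-differ : ∀ {v Vs Ws} → (∃ λ w → w ∈ Vs × v ≡ outside ∷ᵥ w) →
    ¬ (∃ λ w → w ∈ Ws × v ≡ inside ∷ᵥ w)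
  heads-differ (_ , _ , refl) (_ , _ , ())

-- Pascal's rule on the first allowed point: skipping it costs one unit of the slack `e`, choosing
-- it uses up one of the `k` points and forbids the next `r′`.
spreadSets-length : ∀ r′ c k e {n} → n ≡ c + (suc r′ * k + e) →
  (e + k) C k ≤ length (spreadSets r′ c n k)
spreadSets-length r′ (suc c) k       e       {suc n} eq =
  ≤-trans (spreadSets-length r′ c k e (suc-injective eq))
    (≤-reflexive (sym (length-map _ (spreadSets r′ c n k))))
spreadSets-length r′ zero    zero    e       {zero}  eq = ≤-refl
spreadSets-length r′ zero    zero    zero    {suc n} eq =
  contradiction (trans eq (trans (+-identityʳ _) (*-zeroʳ r′))) λ ()
spreadSets-length r′ zero    zero    (suc e) {suc n} eq =
  ≤-trans (spreadSets-length r′ zero zero e (suc-injective (trans eq (+-suc (r′ * 0) e))))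
    (≤-reflexive (sym (length-map _ (spreadSets r′ zero n zero))))
spreadSets-length r′ zero    (suc k) e       {suc n} eq = begin
  (e + suc k) C suc k          ≤⟨ split e eq ⟩
  length free + length used    ≡⟨ cong₂ _+_ (length-map _ free) (length-map _ used) ⟨
  length (map (outside ∷ᵥ_) free) + length (map (inside ∷ᵥ_) used)
                               ≡⟨ length-++ (map (outside ∷ᵥ_) free) ⟨
  length (map (outside ∷ᵥ_) free ++ map (inside ∷ᵥ_) used) ∎
  where
  open ≤-Reasoning
  free = spreadSets r′ zero n (suc k)
  used = spreadSets r′ r′ n k

  used-length : ∀ e → suc n ≡ suc r′ * suc k + e → (e + k) C k ≤ length used
  used-length e eq = spreadSets-length r′ r′ k e (suc-injective (trans eq
    (trans (cong (_+ e) (*-suc (suc r′) k)) (+-assoc (suc r′) (suc r′ * k) e))))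

  split : ∀ e → suc n ≡ suc r′ * suc k + e → (e + suc k) C suc k ≤ length free + length used
  -- Without slack the first point has to be chosen, and both binomials are 1.
  split zero    eq = ≤-trans (≤-reflexive (trans (nCn≡1 (suc k)) (sym (nCn≡1 k))))
    (≤-trans (used-length zero eq) (m≤n+m _ (length free)))
  split (suc e) eq = begin
    suc (e + suc k) C suc k                   ≡⟨ nCk+nC[k+1]≡[n+1]C[k+1] (e + suc k) k ⟨
    (e + suc k) C k + (e + suc k) C suc k     ≡⟨ +-comm ((e + suc k) C k) _ ⟩
    (e + suc k) C suc k + (e + suc k) C k     ≡⟨ cong (λ x → (e + suc k) C suc k + x C k) (+-suc e k) ⟩
    (e + suc k) C suc k + (suc e + k) C k     ≤⟨ +-mono-≤
      (spreadSets-length r′ zero (suc k) e (suc-injective (trans eq (+-suc _ e))))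
      (used-length (suc e) eq) ⟩
    length free + length used                 ∎

-- `end` keeps every arc across the end of the row long; `room` is what yields `end` for a newly
-- chosen first point.
record Spread (r′ c n k : ℕ) (v : Subset n) : Set where
  field
    size  : ∣ v ∣ ≡ k
    room  : c ≤ n
    start : ∀ {f} → f ∈ₛ v → c ≤ toℕ f
    end   : ∀ {f} → f ∈ₛ v → toℕ f + suc r′ ≤ n
    gaps  : ∀ {f g} → f ∈ₛ v → g ∈ₛ v → toℕ f < toℕ g → toℕ f + suc r′ ≤ toℕ g
open Spread

outside-spread : ∀ {r′ c n k v} → Spread r′ c n k v → Spread r′ (suc c) (suc n) k (outside ∷ᵥ v)
outside-spread s = record
  { size  = size s
  ; room  = s≤s (room s)
  ; start = λ { (there f∈) → s≤s (start s f∈) }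
  ; end   = λ { (there f∈) → s≤s (end s f∈) }
  ; gaps  = λ { (there f∈) (there g∈) (s≤s f<g) → s≤s (gaps s f∈ g∈ f<g) }
  }

inside-spread : ∀ {r′ n k v} → Spread r′ r′ n k v → Spread r′ 0 (suc n) (suc k) (inside ∷ᵥ v)
inside-spread s = record
  { size  = cong suc (size s)
  ; room  = z≤n
  ; start = λ _ → z≤n
  ; end   = λ { here → s≤s (room s) ; (there f∈) → s≤s (end s f∈) }
  ; gaps  = λ { here (there g∈) _ → s≤s (start s g∈)
              ; (there f∈) (there g∈) (s≤s f<g) → s≤s (gaps s f∈ g∈ f<g) }
  }

forget-start : ∀ {r′ c n k v} → Spread r′ c n k v → Spread r′ 0 n k v
forget-start s = record
  { size = size s ; room = z≤n ; start = λ _ → z≤n ; end = end s ; gaps = gaps s }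

spreadSets-spread : ∀ r′ c n k → All (Spread r′ c n k) (spreadSets r′ c n k)
spreadSets-spread r′ zero    zero    zero    =
  record { size = refl ; room = z≤n ; start = λ () ; end = λ () ; gaps = λ () } ∷ []
spreadSets-spread r′ zero    zero    (suc k) = []
spreadSets-spread r′ (suc c) zero    k       = []
spreadSets-spread r′ (suc c) (suc n) k       =
  All.map⁺ (All.map outside-spread (spreadSets-spread r′ c n k))
spreadSets-spread r′ zero    (suc n) zero    =
  All.map⁺ (All.map (forget-start ∘ outside-spread) (spreadSets-spread r′ zero n zero))
spreadSets-spread r′ zero    (suc n) (suc k) = All.++⁺
  (All.map⁺ (All.map (forget-start ∘ outside-spread) (spreadSets-spread r′ zero n (suc k))))
  (All.map⁺ (All.map inside-spread (spreadSets-spread r′ r′ n k)))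

spread-stable : ∀ {r′ n k v} → Spread r′ 0 n k v → IsStable n (suc r′) v
spread-stable {r′} {n} s i j i∈ j∈ i≢j with <-cmp (toℕ i) (toℕ j)
... | tri< i<j _ _ = cyc-distance⁺ (gaps s i∈ j∈ i<j) (end s j∈)
... | tri≈ _ i≡j _ = contradiction (toℕ-injective i≡j) i≢j
... | tri> _ _ j<i = subst (λ d → suc r′ ≤ d ⊓ (n ∸ d)) (∣-∣-comm (toℕ j) (toℕ i))
  (cyc-distance⁺ (gaps s j∈ i∈ j<i) (end s i∈))

-- All these polygons contain the first point, so both interleavings start with 0, 0 and fail at the
-- first comparison.
spreadSets-independent : ∀ r′ n k →
  IsIndependent (suc n) (suc k) (suc r′) (map (inside ∷ᵥ_) (spreadSets r′ r′ n k))
spreadSets-independent r′ n k =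
  All.map⁺ (All.map (λ s → size (inside-spread s) , spread-stable (inside-spread s))
    (spreadSets-spread r′ r′ n k)) ,
  Unique.map⁺ ∷-injectiveʳ (spreadSets-unique r′ r′ n k) ,
  AllPairs.map⁺ (AllPairs.map (λ {v} {w} _ → λ { (inj₁ (() ∷ _)) ; (inj₂ (() ∷ _)) })
    (spreadSets-unique r′ r′ n k))

-- The two bounds combined, in terms of the slack n - rk.

theorem3 : (n k r : ℕ) → 1 ≤ k → 2 ≤ r → r * k ≤ n →
    IndependenceNumber n k r ((n ∸ (r ∸ 1) * k ∸ 1) C (k ∸ 1))
theorem3 (suc n) (suc k) (suc r′) _ 2≤r rk≤n =
  subst (λ m → IndependenceNumber (suc n) (suc k) (suc r′) (m C k)) (sym value)
    ( ( map (inside ∷ᵥ_) sets , spreadSets-independent r′ n k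
      -- Counting bounds the explicit family only from below; the upper bound, applied to this
      -- family, gives its exact size.
      , ≤-antisym (upper _ (spreadSets-independent r′ n k)) lower )
    , upper )
  where
  d = suc n ∸ suc r′ * suc k
  sets = spreadSets r′ r′ n k

  n≡ : suc n ≡ suc r′ * suc k + d
  n≡ = sym (m+[n∸m]≡n rk≤n)

  r≤n : suc r′ ≤ suc n
  r≤n = ≤-trans (m≤m*n (suc r′) (suc k)) rk≤n

  value : suc n ∸ r′ * suc k ∸ 1 ≡ k + d
  value = begin
    suc n ∸ r′ * suc k ∸ 1                         ≡⟨ cong (λ x → x ∸ r′ * suc k ∸ 1) n≡ ⟩
    (suc k + r′ * suc k) + d ∸ r′ * suc k ∸ 1      ≡⟨ cong (λ x → x + d ∸ r′ * suc k ∸ 1) (+-comm (suc k) _) ⟩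
    (r′ * suc k + suc k) + d ∸ r′ * suc k ∸ 1      ≡⟨ cong (λ x → x ∸ r′ * suc k ∸ 1) (+-assoc (r′ * suc k) (suc k) d) ⟩
    r′ * suc k + (suc k + d) ∸ r′ * suc k ∸ 1      ≡⟨ cong (_∸ 1) (m+n∸m≡n (r′ * suc k) (suc k + d)) ⟩
    k + d                                          ∎
    where open ≡-Reasoning

  upper : ∀ S → IsIndependent (suc n) (suc k) (suc r′) S → length S ≤ (k + d) C k
  upper S I = subst (_≤ (k + d) C k) (length-map sequence S)
    (independent-bound (suc r′) 2≤r k d n≡ (sequences-independent r≤n I))

  lower : (k + d) C k ≤ length (map (inside ∷ᵥ_) sets)
  lower = subst₂ _≤_ (cong (_C k) (+-comm d k)) (sym (length-map _ sets))
    (spreadSets-length r′ r′ k d (suc-injective (trans n≡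
      (trans (cong (_+ d) (*-suc (suc r′) k)) (+-assoc (suc r′) (suc r′ * k) d)))))
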